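{- Let $v$ be any vertex of an acyclic quiver $Q$, and let $Q_1,Q_2\in[Q]_v$, i.e. $Q_1,Q_2$ are acyclic quivers in the flip-equivalence class $[Q]$ in both of which $v$ is a source. Then there exists a sequence of source-sink flips from $Q_1$ to $Q_2$ such that every intermediate quiver in the sequence also has $v$ as a source. In other words, the flip sequence does not flip at $v$, nor at neighbors of $v$.
   Context: All quivers are finite directed graphs that are simple (no loops, no parallel or anti-parallel arcs) and acyclic (no directed cycles). A source is a vertex all of whose incident arcs point away from it; a sink is a vertex all of whose incident arcs point into it (an isolated vertex is both). A flip at a source or sink $k$ reverses all arcs incident to $k$ (turning a source into a sink or a sink into a source). Two acyclic quivers are equivalent if they are related by a finite sequence of flips; $[Q]$ denotes the equivalence class of $Q$, and $[Q]_v$ denotes the set of quivers in $[Q]$ in which $v$ is a source. -}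

module Defs where

open import Level using (0ℓ)
open import Data.Bool using (Bool; T; _∨_; if_then_else_)
open import Data.Fin using (Fin; _≟_)
open import Data.Nat using (ℕ)
open import Data.Product using (_×_)
open import Data.Sum using (_⊎_)
open import Data.Unit using (⊤)
open import Relation.Binary.Construct.Closure.Transitive using (TransClosure)
open import Relation.Binary.PropositionalEquality using (_≡_)
open import Relation.Nullary using (¬_)
open import Relation.Nullary.Decidable using (⌊_⌋)
open import Relation.Unary using (Pred; _∈_)

-- A Boolean adjacency matrix rules out parallel arcs.  Loops and anti-parallel
-- pairs of arcs are directed cycles of length 1 and 2, so `acyclic` excludes
-- them as well.
record Quiver (n : ℕ) : Set where
  field
    arc : Fin n → Fin n → Bool

  Arc : Fin n → Fin n → Set
  Arc i j = T (arc i j)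

  field
    acyclic : ∀ i → ¬ TransClosure Arc i i

open Quiver public

private
  variable
    n : ℕ

-- Equality of quivers on the labelled vertex set Fin n (not isomorphism):
-- the acyclicity proofs are disregarded.
infix 4 _≈_
_≈_ : Quiver n → Quiver n → Set
Q ≈ R = ∀ i j → arc Q i j ≡ arc R i j

IsSource : Quiver n → Fin n → Set
IsSource Q k = ∀ i → ¬ Arc Q i k

IsSink : Quiver n → Fin n → Set
IsSink Q k = ∀ i → ¬ Arc Q k i

Neighbour : Quiver n → Fin n → Fin n → Set
Neighbour Q v w = Arc Q v w ⊎ Arc Q w v

reverseAt : Fin n → (Fin n → Fin n → Bool) → (Fin n → Fin n → Bool)
reverseAt k a i j = if ⌊ i ≟ k ⌋ ∨ ⌊ j ≟ k ⌋ then a j i else a i j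

Flip : Fin n → Quiver n → Quiver n → Set
Flip k Q R = (IsSource Q k ⊎ IsSink Q k)
           × (∀ i j → arc R i j ≡ reverseAt k (arc Q) i j)

data FlipSequence {n : ℕ} : Quiver n → Quiver n → Set where
  done : ∀ {Q R} → Q ≈ R → FlipSequence Q R
  flip : ∀ {Q R S} (k : Fin n) → Flip k Q R → FlipSequence R S → FlipSequence Q S

-- The endpoints are counted too, the last one as the left-hand side of the
-- equality in `done`.
EveryQuiver : {Q R : Quiver n} → Pred (Quiver n) 0ℓ → FlipSequence Q R → Set
EveryQuiver {Q = Q} P (done _)     = P Q
EveryQuiver {Q = Q} P (flip _ _ s) = P Q × EveryQuiver P s

EveryFlippedVertex : {Q R : Quiver n} → Pred (Fin n) 0ℓ → FlipSequence Q R → Set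
EveryFlippedVertex P (done _)     = ⊤
EveryFlippedVertex P (flip k _ s) = P k × EveryFlippedVertex P s

-- Flips are involutive, so reachability from Q is already an equivalence
-- relation and needs no symmetric closure.
[_] : Quiver n → Pred (Quiver n) 0ℓ
[ Q ] R = FlipSequence Q R

[_]at_ : Quiver n → Fin n → Pred (Quiver n) 0ℓ
([ Q ]at v) R = R ∈ [ Q ] × IsSource R v

{-# OPTIONS --safe #-}

-- Count the flips of a sequence from Q to S at each vertex, a sink-to-source
-- flip as +1 and a source-to-sink flip as -1.  On edges, the resulting height
-- h records the change of orientation: [i → j in S] − [i → j in Q] = h i − h j.
-- Only differences matter, so h may be normalised to vanish at v; if v is a
-- source in both Q and S, then h vanishes at the neighbours of v too.
-- Conversely, every such h is realised by flips at vertices where h is nonzero: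
-- h weakly increases along the arcs of Q, so if h is positive somewhere, then it
-- is positive at a sink, and dually for negative values and sources; flipping
-- there brings h closer to zero.
module Submission where

open import Data.Bool using (Bool; true; false; T)
open import Data.Bool.Properties using (T?)
open import Data.Empty using (⊥-elim)
open import Data.Fin using (Fin; zero; suc; _≟_)
open import Data.Fin.Induction using (spo-wellFounded; spo-noetherian)
open import Data.Fin.Properties using (any?)
open import Data.Integer as ℤ using (ℤ; +_; -[1+_]; 0ℤ; 1ℤ; -1ℤ; _+_; -_; _-_; ∣_∣; +<+)
import Data.Integer.Properties as ℤₚ
open import Data.Integer.Tactic.RingSolver using (solve-∀)
open import Data.Nat as ℕ using (ℕ)
import Data.Nat.Properties as ℕₚ
open import Data.Nat.Induction using (<-wellFounded)
open import Data.Product using (Σ-syntax; ∃; _×_; _,_; proj₁; proj₂)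
open import Data.Sum as Sum using (_⊎_; inj₁; inj₂; swap)
open import Data.Unit using (tt)
open import Function as Fun using (_∘_)
open import Induction.WellFounded using (WellFounded; Acc; acc; module Subrelation)
open import Relation.Binary using (Decidable; IsStrictPartialOrder; tri<; tri≈; tri>)
open import Relation.Binary.Construct.Closure.Transitive
  using (TransClosure; [_]; _∷_; _++_; wellFounded⁻)
open import Relation.Binary.PropositionalEquality
  using (_≡_; _≢_; refl; sym; trans; cong; subst; subst₂; resp₂; isEquivalence; module ≡-Reasoning)
open import Relation.Nullary using (¬_; yes; no; ¬?)
open import Relation.Nullary.Decidable using (decidable-stable)
open import Relation.Unary using (_∈_)
open import Algebra.Properties.AbelianGroup ℤₚ.+-0-abelianGroup using () renaming (∙-cancelˡ to +-cancelˡ)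
open import Algebra.Properties.Monoid.Sum ℕₚ.+-0-monoid using (sum)
open import Defs hiding ([_])

private
  variable
    n : ℕ
    Q R S : Quiver n
    f g h : Fin n → ℤ
    i j k v : Fin n

-- Acyclicity as well-foundedness, and extremal vertices

minimal : ∀ {A : Fin n → Fin n → Set} {P : Fin n → Set} →
          WellFounded A → Decidable A → (∀ {i j} → A i j → P j → P i) →
          ∃ P → Σ[ k ∈ Fin n ] (P k × ∀ i → ¬ A i k)
minimal {n} {A} {P} wf A? closed (k , Pk) = go (wf k) Pk
  where
  -- Since `P` passes to predecessors, the walk backwards never leaves `P`; it can stop only where
  -- there is no predecessor at all, inside `P` or outside.
  go : ∀ {k} → Acc A k → P k → Σ[ m ∈ Fin n ] (P m × ∀ i → ¬ A i m)
  go {k} (acc rec) Pk with any? (λ i → A? i k)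
  ... | yes (i , Aik) = go (rec Aik) (closed Aik Pk)
  ... | no  ¬A        = k , Pk , λ i Aik → ¬A (i , Aik)

arcs⁺-isStrictPartialOrder : (Q : Quiver n) → IsStrictPartialOrder _≡_ (TransClosure (Arc Q))
arcs⁺-isStrictPartialOrder Q = record
  { isEquivalence = isEquivalence
  ; irrefl        = λ { refl → acyclic Q _ }
  ; trans         = _++_
  ; <-resp-≈      = resp₂ _
  }

arcs-wellFounded : (Q : Quiver n) → WellFounded (Arc Q)
arcs-wellFounded Q = wellFounded⁻ _ (spo-wellFounded (arcs⁺-isStrictPartialOrder Q))

arcs-noetherian : (Q : Quiver n) → WellFounded (Fun.flip (Arc Q))
arcs-noetherian Q = Subrelation.wellFounded [_] (spo-noetherian (arcs⁺-isStrictPartialOrder Q))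

-- Flips preserve acyclicity

reverseAt-on : ∀ (a : Fin n → Fin n → Bool) → i ≡ k ⊎ j ≡ k → reverseAt k a i j ≡ a j i
reverseAt-on {i = i} {k = k} {j = j} a on with i ≟ k | j ≟ k
... | yes _   | _       = refl
... | no _    | yes _   = refl
... | no i≢k  | no j≢k  = ⊥-elim (Sum.[ i≢k , j≢k ] on)

reverseAt-off : ∀ (a : Fin n → Fin n → Bool) → i ≢ k → j ≢ k → reverseAt k a i j ≡ a i j
reverseAt-off {i = i} {k = k} {j = j} a i≢k j≢k with i ≟ k | j ≟ k
... | yes i≡k | _       = ⊥-elim (i≢k i≡k)
... | no _    | yes j≡k = ⊥-elim (j≢k j≡k)
... | no _    | no _    = refl

flipAt : (k : Fin n) (Q : Quiver n) → IsSource Q k ⊎ IsSink Q k → Quiver n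
flipAt {n} k Q extremal = record { arc = reverseAt k (arc Q) ; acyclic = acyclic′ }
  where
  A : Fin n → Fin n → Set
  A i j = T (reverseAt k (arc Q) i j)

  -- After the reversal `k` is still extremal, so no walk passes through it: a cycle would have to
  -- avoid `k` and would already be a cycle of `Q`.
  blocked : A i k → ¬ A k j
  blocked {i} {j} Aik Akj = Sum.[ (λ source → source j (subst T (reverseAt-on (arc Q) (inj₁ refl)) Akj))
                                , (λ sink   → sink i (subst T (reverseAt-on (arc Q) (inj₂ refl)) Aik)) ] extremal

  first : TransClosure A i j → ∃ (A i)
  first [ a ]   = _ , a
  first (a ∷ _) = _ , a

  last : TransClosure A i j → ∃ (λ m → A m j)
  last [ a ]   = _ , a
  last (_ ∷ p) = last p

  avoids : i ≢ k → j ≢ k → TransClosure A i j → TransClosure (Arc Q) i j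
  avoids i≢k j≢k [ a ] = [ subst T (reverseAt-off (arc Q) i≢k j≢k) a ]
  avoids i≢k j≢k (a ∷ p) = subst T (reverseAt-off (arc Q) i≢k m≢k) a ∷ avoids m≢k j≢k p
    where
    m≢k : _ ≢ k
    m≢k refl = blocked a (proj₂ (first p))

  acyclic′ : ∀ i → ¬ TransClosure A i i
  acyclic′ i p with i ≟ k
  ... | yes refl = blocked (proj₂ (last p)) (proj₂ (first p))
  ... | no  i≢k  = acyclic Q i (avoids i≢k i≢k p)

-- Height functions between orientations of one graph

χ : Bool → ℤ
χ true  = 1ℤ
χ false = 0ℤ

χ-injective : ∀ {a b} → χ a ≡ χ b → a ≡ b
χ-injective {true}  {true}  _ = refl
χ-injective {false} {false} _ = refl

infix 4 _⟶[_]_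
-- The height equation is written without subtraction and only for edges, as the heights of
-- non-adjacent vertices are unrelated. `forth` and `back` therefore have to say separately that the
-- underlying graphs agree.
record _⟶[_]_ (Q : Quiver n) (h : Fin n → ℤ) (S : Quiver n) : Set where
  field
    forth  : ∀ {i j} → Neighbour Q i j → Neighbour S i j
    back   : ∀ {i j} → Neighbour S i j → Neighbour Q i j
    height : ∀ {i j} → Neighbour Q i j → χ (arc S i j) + h j ≡ χ (arc Q i j) + h i

open _⟶[_]_

≈⇒⟶ : Q ≈ R → Q ⟶[ (λ _ → 0ℤ) ] R
≈⇒⟶ {Q = Q} {R = R} Q≈R = record
  { forth  = Sum.map (subst T (Q≈R _ _)) (subst T (Q≈R _ _))
  ; back   = Sum.map (subst T (sym (Q≈R _ _))) (subst T (sym (Q≈R _ _)))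
  ; height = λ {i} {j} _ → cong (λ b → χ b + 0ℤ) (sym (Q≈R i j))
  }

⟶-trans : Q ⟶[ f ] R → R ⟶[ g ] S → Q ⟶[ (λ i → f i + g i) ] S
⟶-trans {Q = Q} {f = f} {R = R} {g = g} {S = S} p q = record
  { forth  = forth q ∘ forth p
  ; back   = back p ∘ back q
  ; height = λ {i} {j} nb → begin
      χ (arc S i j) + (f j + g j) ≡⟨ regroup₁ (χ (arc S i j)) (f j) (g j) ⟩
      χ (arc S i j) + g j + f j   ≡⟨ cong (_+ f j) (height q (forth p nb)) ⟩
      χ (arc R i j) + g i + f j   ≡⟨ regroup₂ (χ (arc R i j)) (g i) (f j) ⟩
      χ (arc R i j) + f j + g i   ≡⟨ cong (_+ g i) (height p nb) ⟩
      χ (arc Q i j) + f i + g i   ≡⟨ ℤₚ.+-assoc (χ (arc Q i j)) (f i) (g i) ⟩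
      χ (arc Q i j) + (f i + g i) ∎
  }
  where
  open ≡-Reasoning
  regroup₁ : ∀ x a b → x + (a + b) ≡ x + b + a
  regroup₁ = solve-∀
  regroup₂ : ∀ x a b → x + a + b ≡ x + b + a
  regroup₂ = solve-∀

⟶-sym : Q ⟶[ h ] R → R ⟶[ (λ i → - h i) ] Q
⟶-sym {Q = Q} {h = h} {R = R} p = record
  { forth  = back p
  ; back   = forth p
  ; height = λ {i} {j} nb → begin
      χ (arc Q i j) - h j             ≡⟨ regroup (χ (arc Q i j)) (h i) (h j) ⟩
      χ (arc Q i j) + h i - h i - h j ≡⟨ cong (λ x → x - h i - h j) (sym (height p (back p nb))) ⟩
      χ (arc R i j) + h j - h i - h j ≡⟨ cancel (χ (arc R i j)) (h i) (h j) ⟩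
      χ (arc R i j) - h i             ∎
  }
  where
  open ≡-Reasoning
  regroup : ∀ x a b → x - b ≡ x + a - a - b
  regroup = solve-∀
  cancel : ∀ x a b → x + b - a - b ≡ x - a
  cancel = solve-∀

⟶-shift : ∀ c → Q ⟶[ h ] R → Q ⟶[ (λ i → h i - c) ] R
⟶-shift {Q = Q} {h = h} {R = R} c p = record
  { forth  = forth p
  ; back   = back p
  ; height = λ {i} {j} nb → begin
      χ (arc R i j) + (h j - c) ≡⟨ sym (ℤₚ.+-assoc (χ (arc R i j)) (h j) (- c)) ⟩
      χ (arc R i j) + h j - c   ≡⟨ cong (_- c) (height p nb) ⟩
      χ (arc Q i j) + h i - c   ≡⟨ ℤₚ.+-assoc (χ (arc Q i j)) (h i) (- c) ⟩
      χ (arc Q i j) + (h i - c) ∎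
  }
  where open ≡-Reasoning

-- The height of a single flip

spike : Fin n → ℤ → Fin n → ℤ
spike k c i with i ≟ k
... | yes _ = c
... | no  _ = 0ℤ

spike-on : ∀ (k : Fin n) c → spike k c k ≡ c
spike-on k c with k ≟ k
... | yes _  = refl
... | no k≢k = ⊥-elim (k≢k refl)

spike-off : ∀ {k i : Fin n} c → i ≢ k → spike k c i ≡ 0ℤ
spike-off {k = k} {i} c i≢k with i ≟ k
... | yes i≡k = ⊥-elim (i≢k i≡k)
... | no _    = refl

spin : IsSource Q k ⊎ IsSink Q k → ℤ
spin (inj₁ _) = -1ℤ
spin (inj₂ _) = 1ℤ

only-second : ∀ {a b} → ¬ T a → T a ⊎ T b → a ≡ false × b ≡ true
only-second {true}          ¬a _        = ⊥-elim (¬a tt)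
only-second {false} {true}  _  _        = refl , refl
only-second {false} {false} _  (inj₁ ())
only-second {false} {false} _  (inj₂ ())

loopless : (Q : Quiver n) → ¬ Neighbour Q i i
loopless Q = Sum.[ acyclic Q _ ∘ [_] , acyclic Q _ ∘ [_] ]

flip⇒⟶ : (F : Flip k Q R) → Q ⟶[ spike k (spin {Q = Q} (proj₁ F)) ] R
flip⇒⟶ {k = k} {Q = Q} {R = R} (extremal , R≡) = record
  { forth  = forth′
  ; back   = back′
  ; height = height′
  }
  where
  on : i ≡ k ⊎ j ≡ k → arc R i j ≡ arc Q j i
  on {i} {j} i≡k⊎j≡k = trans (R≡ i j) (reverseAt-on (arc Q) i≡k⊎j≡k)

  off : i ≢ k → j ≢ k → arc R i j ≡ arc Q i j
  off {i} {j} i≢k j≢k = trans (R≡ i j) (reverseAt-off (arc Q) i≢k j≢k)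

  forth′ : Neighbour Q i j → Neighbour R i j
  forth′ {i} {j} nb with i ≟ k | j ≟ k
  ... | yes i≡k | _       = swap (Sum.map (subst T (sym (on (inj₂ i≡k)))) (subst T (sym (on (inj₁ i≡k)))) nb)
  ... | no _    | yes j≡k = swap (Sum.map (subst T (sym (on (inj₁ j≡k)))) (subst T (sym (on (inj₂ j≡k)))) nb)
  ... | no i≢k  | no j≢k  = Sum.map (subst T (sym (off i≢k j≢k))) (subst T (sym (off j≢k i≢k))) nb

  back′ : Neighbour R i j → Neighbour Q i j
  back′ {i} {j} nb with i ≟ k | j ≟ k
  ... | yes i≡k | _       = swap (Sum.map (subst T (on (inj₁ i≡k))) (subst T (on (inj₂ i≡k))) nb)
  ... | no _    | yes j≡k = swap (Sum.map (subst T (on (inj₂ j≡k))) (subst T (on (inj₁ j≡k))) nb)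
  ... | no i≢k  | no j≢k  = Sum.map (subst T (off i≢k j≢k)) (subst T (off j≢k i≢k)) nb

  δ : ℤ
  δ = spin {Q = Q} extremal

  -- Extremality of `k` decides which of the two possible arcs is present. Read from right to left,
  -- the same equation serves the edges with `k` as second endpoint.
  leaving : ∀ (e : IsSource Q k ⊎ IsSink Q k) → Neighbour Q k j →
            χ (arc Q j k) + 0ℤ ≡ χ (arc Q k j) + spin {Q = Q} e
  leaving {j} (inj₁ source) nb
    rewrite proj₁ (only-second (source j) (swap nb)) | proj₂ (only-second (source j) (swap nb)) = refl
  leaving {j} (inj₂ sink) nb
    rewrite proj₁ (only-second (sink j) nb) | proj₂ (only-second (sink j) nb) = refl

  height′ : Neighbour Q i j → χ (arc R i j) + spike k δ j ≡ χ (arc Q i j) + spike k δ i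
  height′ {i} {j} nb with i ≟ k | j ≟ k
  ... | yes refl | yes refl = ⊥-elim (loopless Q nb)
  ... | yes refl | no _     = trans (cong (λ b → χ b + 0ℤ) (on (inj₁ refl))) (leaving extremal nb)
  ... | no _     | yes refl = trans (cong (λ b → χ b + δ) (on (inj₂ refl))) (sym (leaving extremal (swap nb)))
  ... | no i≢k   | no j≢k   = cong (λ b → χ b + 0ℤ) (off i≢k j≢k)

sequence⇒⟶ : FlipSequence Q R → ∃ (λ h → Q ⟶[ h ] R)
sequence⇒⟶ (done Q≈R)   = _ , ≈⇒⟶ Q≈R
sequence⇒⟶ (flip k F s) = _ , ⟶-trans (flip⇒⟶ F) (proj₂ (sequence⇒⟶ s))

-- Realising a height function by flips

increasing : Q ⟶[ h ] S → Arc Q i j → h i ℤ.≤ h j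
increasing {Q = Q} {h = h} {S = S} {i = i} {j = j} p Qij
  with arc Q i j | arc S i j | Qij | height p (inj₁ Qij)
-- An arc kept in `S` joins equal heights; a reversed one raises the height by exactly one.
... | true | true  | _ | e = ℤₚ.≤-reflexive (sym (+-cancelˡ 1ℤ _ _ e))
... | true | false | _ | e = ℤₚ.≤-trans (ℤₚ.i≤suc[i] (h i)) (ℤₚ.≤-reflexive (trans (sym e) (ℤₚ.+-identityˡ (h j))))

-- `- 1ℤ + x` is the height still to be realised at a sink once it has been flipped; `closer⁻` is
-- the counterpart for a source.
closer⁺ : ∀ {x} → 0ℤ ℤ.< x → ∣ - 1ℤ + x ∣ ℕ.< ∣ x ∣
closer⁺ {+ ℕ.suc m} _ = ℕₚ.n<1+n m
closer⁺ {+ ℕ.zero} (+<+ ())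

closer⁻ : ∀ {x} → x ℤ.< 0ℤ → ∣ - -1ℤ + x ∣ ℕ.< ∣ x ∣
closer⁻ { -[1+ ℕ.zero ] }  _ = ℕ.s≤s ℕ.z≤n
closer⁻ { -[1+ ℕ.suc m ] } _ = ℕₚ.n<1+n (ℕ.suc m)
closer⁻ {+ _} (+<+ ())

-- The vertex found is extremal of the right kind: `spin` has the sign of `h` there, so the flip
-- does not lead away from zero.
descent-vertex : Q ⟶[ h ] S → ∃ (λ k → h k ≢ 0ℤ) →
                 Σ[ k ∈ Fin _ ] Σ[ e ∈ IsSource Q k ⊎ IsSink Q k ]
                   ∣ - spin {Q = Q} e + h k ∣ ℕ.< ∣ h k ∣
descent-vertex {Q = Q} {h = h} p (k , hk≢0) with ℤₚ.<-cmp 0ℤ (h k)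
... | tri≈ _ 0≡hk _ = ⊥-elim (hk≢0 (sym 0≡hk))
... | tri< 0<hk _ _ =
  let m , 0<hm , sink = minimal (arcs-noetherian Q) (λ _ _ → T? _)
                          (λ Qji 0<hj → ℤₚ.<-≤-trans 0<hj (increasing p Qji)) (k , 0<hk)
  in m , inj₂ sink , closer⁺ 0<hm
... | tri> _ _ hk<0 =
  let m , hm<0 , source = minimal (arcs-wellFounded Q) (λ _ _ → T? _)
                            (λ Qij hj<0 → ℤₚ.≤-<-trans (increasing p Qij) hj<0) (k , hk<0)
  in m , inj₁ source , closer⁻ hm<0

sum-mono-≤ : ∀ {f g : Fin n → ℕ} → (∀ i → f i ℕ.≤ g i) → sum f ℕ.≤ sum g
sum-mono-≤ {ℕ.zero}  f≤g = ℕ.z≤n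
sum-mono-≤ {ℕ.suc n} f≤g = ℕₚ.+-mono-≤ (f≤g zero) (sum-mono-≤ (f≤g ∘ suc))

sum-mono-< : ∀ {f g : Fin n → ℕ} → (∀ i → f i ℕ.≤ g i) → ∀ k → f k ℕ.< g k → sum f ℕ.< sum g
sum-mono-< f≤g zero    fk<gk = ℕₚ.+-mono-<-≤ fk<gk (sum-mono-≤ (f≤g ∘ suc))
sum-mono-< f≤g (suc k) fk<gk = ℕₚ.+-mono-≤-< (f≤g zero) (sum-mono-< (f≤g ∘ suc) k fk<gk)

same-arc : Q ⟶[ h ] S → (∀ i → h i ≡ 0ℤ) → Neighbour Q i j → arc Q i j ≡ arc S i j
same-arc {Q = Q} {h = h} {S = S} {i = i} {j = j} p h≡0 nb = sym (χ-injective (begin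
  χ (arc S i j)       ≡⟨ sym (ℤₚ.+-identityʳ _) ⟩
  χ (arc S i j) + 0ℤ  ≡⟨ cong (λ x → χ (arc S i j) + x) (sym (h≡0 j)) ⟩
  χ (arc S i j) + h j ≡⟨ height p nb ⟩
  χ (arc Q i j) + h i ≡⟨ cong (λ x → χ (arc Q i j) + x) (h≡0 i) ⟩
  χ (arc Q i j) + 0ℤ  ≡⟨ ℤₚ.+-identityʳ _ ⟩
  χ (arc Q i j)       ∎))
  where open ≡-Reasoning

-- An arc in either quiver makes its endpoints neighbours in `Q`, where the height equation applies;
-- otherwise both entries are `false`.
zero-height⇒≈ : Q ⟶[ h ] S → (∀ i → h i ≡ 0ℤ) → Q ≈ S
zero-height⇒≈ {Q = Q} {h = h} {S = S} p h≡0 i j with T? (arc Q i j) | T? (arc S i j)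
... | no ¬Qij | no ¬Sij = trans (¬T⇒false ¬Qij) (sym (¬T⇒false ¬Sij))
  where
  ¬T⇒false : ∀ {b} → ¬ T b → b ≡ false
  ¬T⇒false {false} _  = refl
  ¬T⇒false {true}  ¬b = ⊥-elim (¬b tt)
... | yes Qij | _       = same-arc p h≡0 (inj₁ Qij)
... | no _    | yes Sij = same-arc p h≡0 (back p (inj₁ Sij))

mapFlipped : ∀ {P P′ : Fin n → Set} → (∀ {k} → P k → P′ k) →
             (s : FlipSequence Q R) → EveryFlippedVertex P s → EveryFlippedVertex P′ s
mapFlipped P⇒P′ (done _)     _          = tt
mapFlipped P⇒P′ (flip _ _ s) (Pk , all) = P⇒P′ Pk , mapFlipped P⇒P′ s all

-- Induction on the total absolute height: a flip lowers the summand at `k` and leaves the others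
-- alone. That zeros of `h` are never flipped is what later protects `v` and its neighbours.
realise : Q ⟶[ h ] S → Acc ℕ._<_ (sum (λ i → ∣ h i ∣)) →
          Σ[ s ∈ FlipSequence Q S ] EveryFlippedVertex (λ k → h k ≢ 0ℤ) s
realise {Q = Q} {h = h} {S = S} p (acc rec) with any? (λ k → ¬? (h k ℤₚ.≟ 0ℤ))
... | no  all-zero = done (zero-height⇒≈ p (λ i → decidable-stable (h i ℤₚ.≟ 0ℤ) (λ hi≢0 → all-zero (i , hi≢0)))) , tt
... | yes nonzero with descent-vertex p nonzero
... | k , e , closer =
  let s , flipped = realise p′ (rec (sum-mono-< shrinks k strictly))
  in flip k F s , (λ hk≡0 → ℕₚ.n≮0 (subst (λ x → ∣ - spin {Q = Q} e + h k ∣ ℕ.< ∣ x ∣) hk≡0 closer)) , mapFlipped nonzero′ s flipped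
  where
  F : Flip k Q (flipAt k Q e)
  F = e , λ _ _ → refl

  h′ : Fin _ → ℤ
  h′ i = - spike k (spin {Q = Q} e) i + h i

  p′ : flipAt k Q e ⟶[ h′ ] S
  -- Undoing the flip and then passing to `S` gives the remaining height.
  p′ = ⟶-trans (⟶-sym (flip⇒⟶ F)) p

  strictly : ∣ h′ k ∣ ℕ.< ∣ h k ∣
  strictly = subst (λ c → ∣ - c + h k ∣ ℕ.< ∣ h k ∣) (sym (spike-on k _)) closer

  shrinks : ∀ i → ∣ h′ i ∣ ℕ.≤ ∣ h i ∣
  shrinks i with i ≟ k
  ... | yes refl = ℕₚ.<⇒≤ closer
  ... | no  _    = ℕₚ.≤-reflexive (cong ∣_∣ (ℤₚ.+-identityˡ (h i)))

  -- Absolute values never grow, so a zero of `h` remains a zero throughout the recursion.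
  nonzero′ : ∀ {i} → h′ i ≢ 0ℤ → h i ≢ 0ℤ
  nonzero′ {i} h′i≢0 hi≡0 =
    h′i≢0 (ℤₚ.∣i∣≡0⇒i≡0 (ℕₚ.n≤0⇒n≡0 (subst (λ x → ∣ h′ i ∣ ℕ.≤ ∣ x ∣) hi≡0 (shrinks i))))

-- Sequences that keep a vertex a source

stays-source : IsSource Q v → (s : FlipSequence Q R) →
               EveryFlippedVertex (λ k → k ≢ v × ¬ Neighbour Q v k) s →
               EveryQuiver (λ R → IsSource R v) s
stays-source source (done _) _ = source
stays-source {Q = Q} {v = v} source (flip {R = R} k F s) ((k≢v , ¬nb) , avoided) =
  source , stays-source source′ s
    (mapFlipped (λ (m≢v , ¬nb′) → m≢v , ¬nb′ ∘ back Q⟶R) s avoided)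
  where
  Q⟶R : Q ⟶[ _ ] R
  Q⟶R = flip⇒⟶ F

  -- An arc of `R` into `v` either comes from `k`, making `k` a neighbour, or is untouched by the
  -- flip and was already in `Q`.
  source′ : IsSource R v
  source′ i Riv with i ≟ k
  ... | yes refl = ¬nb (back Q⟶R (inj₂ Riv))
  ... | no  i≢k  = source i (subst T (trans (proj₂ F i v) (reverseAt-off (arc Q) i≢k (k≢v ∘ sym))) Riv)

-- The edge points from `v` to `k` in both quivers, so the two values of `χ` are 1 and cancel.
height-at-neighbour : Q ⟶[ h ] S → IsSource Q v → IsSource S v → Neighbour Q v k → h k ≡ h v
height-at-neighbour {Q = Q} {h = h} {S = S} {v = v} {k = k} p Qv Sv nb = +-cancelˡ 1ℤ _ _
  (subst₂ (λ a b → χ a + h k ≡ χ b + h v)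
     (proj₂ (only-second (Sv k) (swap (forth p nb))))
     (proj₂ (only-second (Qv k) (swap nb)))
     (height p nb))

theorem1p9 : ∀ {n : ℕ} (Q : Quiver n) (v : Fin n) (Q₁ Q₂ : Quiver n) →
    Q₁ ∈ [ Q ]at v → Q₂ ∈ [ Q ]at v →
    Σ[ s ∈ FlipSequence Q₁ Q₂ ]
    (EveryQuiver (λ R → IsSource R v) s
    × EveryFlippedVertex (λ k → k ≢ v × ¬ Neighbour Q v k) s)
theorem1p9 Q v Q₁ Q₂ (s₁ , source₁) (s₂ , source₂) =
  -- Neighbours in `Q₁` are translated to neighbours in `Q`: flips do not change the underlying
  -- graph.
  s , stays-source source₁ s (mapFlipped (λ (k≢v , ¬nb) → k≢v , ¬nb ∘ back p₁) s flipped) , flipped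
  where
  p₁ : Q ⟶[ _ ] Q₁
  p₁ = proj₂ (sequence⇒⟶ s₁)

  -- The height of the detour from `Q₁` back to `Q` and on to `Q₂`.
  Δ : Fin _ → ℤ
  Δ i = - proj₁ (sequence⇒⟶ s₁) i + proj₁ (sequence⇒⟶ s₂) i

  p : Q₁ ⟶[ Δ ] Q₂
  p = ⟶-trans (⟶-sym p₁) (proj₂ (sequence⇒⟶ s₂))

  realisation : Σ[ s ∈ FlipSequence Q₁ Q₂ ] EveryFlippedVertex (λ k → Δ k - Δ v ≢ 0ℤ) s
  -- Subtracting `Δ v` makes the height zero at `v`, so that `realise` leaves `v` alone.
  realisation = realise (⟶-shift (Δ v) p) (<-wellFounded _)

  s : FlipSequence Q₁ Q₂
  s = proj₁ realisation

  flipped : EveryFlippedVertex (λ k → k ≢ v × ¬ Neighbour Q v k) s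
  flipped = mapFlipped (λ {k} Δk≢Δv →
      (λ { refl → Δk≢Δv (ℤₚ.+-inverseʳ (Δ v)) })
    , (λ nb → Δk≢Δv (ℤₚ.i≡j⇒i-j≡0 (height-at-neighbour p source₁ source₂ (forth p₁ nb)))))
    s (proj₂ realisation)
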